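{- Let $k\le m$ and $l\le n$ be positive integers, and let $e$ denote all-ones vectors (of length $m$ in $ke$ and of length $n$ in $le$). The class $\mathcal{C}_{m,n}(ke,le)$ is nonempty if and only if $m=pl$ and $n=pk$ for some integer $p$.
   Context: $\mathcal{C}_{m,n}(R,S)$ denotes the set of $m\times n$ $(0,1)$-matrices with row sum vector $R$ and column sum vector $S$ that are convex, i.e. in every row and every column the 1's occur in consecutive positions. Thus $\mathcal{C}_{m,n}(ke,le)$ consists of the convex $m\times n$ $(0,1)$-matrices with every row sum equal to $k$ and every column sum equal to $l$. -}

module Defs where

open import Data.Fin using (Fin; toℕ; _≤_)
open import Data.Fin.Patterns using (1F)
open import Data.Nat using (ℕ)
open import Data.Nat.Properties using (+-0-commutativeMonoid)
open import Data.Vec.Functional using (Vector; transpose)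
open import Level using (0ℓ)
open import Relation.Binary.PropositionalEquality using (_≡_; _≗_)
open import Relation.Unary using (Pred)
open import Algebra.Properties.CommutativeMonoid.Sum +-0-commutativeMonoid using (sum)

Matrix01 : ℕ → ℕ → Set
Matrix01 m n = Vector (Vector (Fin 2) n) m

lineSum : ∀ {n} → Vector (Fin 2) n → ℕ
lineSum v = sum (λ j → toℕ (v j))

rowSums : ∀ {m n} → Matrix01 m n → Vector ℕ m
rowSums A i = lineSum (A i)

colSums : ∀ {m n} → Matrix01 m n → Vector ℕ n
colSums A = rowSums (transpose A)

Consecutive : ∀ {n} → Vector (Fin 2) n → Set
Consecutive v = ∀ a b c → a ≤ b → b ≤ c → v a ≡ 1F → v c ≡ 1F → v b ≡ 1F

record Convex {m n : ℕ} (A : Matrix01 m n) : Set where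
  field
    rows : ∀ i → Consecutive (A i)
    cols : ∀ j → Consecutive (transpose A j)

record IsInClass {m n : ℕ} (R : Vector ℕ m) (S : Vector ℕ n) (A : Matrix01 m n) : Set where
  field
    rowSums≗R : rowSums A ≗ R
    colSums≗S : colSums A ≗ S
    convex    : Convex A

𝒞 : ∀ m n → Vector ℕ m → Vector ℕ n → Pred (Matrix01 m n) 0ℓ
𝒞 m n R S = IsInClass R S

{-# OPTIONS --safe #-}

-- Row i occupies an interval of columns starting at some s i.  By induction on
-- q, every row meeting column q k starts there: each row starting at q k also
-- meets column q k + k - 1, and both columns have l ones, so these columns meet
-- the same rows, and a row meeting column (q + 1) k cannot start earlier.
-- Hence k divides n, and counting the ones in two ways gives m = p l.
-- Conversely, p diagonal blocks of size l × k form a matrix of the class.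

module Submission where

open import Data.Fin using (Fin; zero; suc; toℕ; fromℕ<)
open import Data.Fin.Patterns using (0F; 1F)
open import Data.Fin.Properties using (toℕ<n; toℕ-fromℕ<)
open import Data.Integer using (ℤ; +_; _*_; ∣_∣)
open import Data.Integer.Properties using (abs-*; pos-*)
open import Data.Nat as ℕ using (ℕ; zero; suc; pred; z≤n; s≤s; s≤s⁻¹; NonZero; _+_; _/_; _%_; _≤_; _<_)
open import Data.Nat.DivMod using (m≡m%n+[m/n]*n; m%n<n; m/n*n≤m; m<n*o⇒m/o<n; m*n/n≡m; /-monoˡ-≤)
open import Data.Nat.Properties as ℕₚ using (+-0-commutativeMonoid; module ≤-Reasoning)
open import Data.Product using (∃; _×_; _,_; proj₁; proj₂)
open import Data.Vec.Functional using (Vector; replicate; head; tail; transpose)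
open import Function.Base using (_∘_)
open import Function.Bundles using (_⇔_; mk⇔; Equivalence)
open import Relation.Binary.PropositionalEquality using (_≡_; refl; sym; trans; cong; cong₂; subst; module ≡-Reasoning)
open import Relation.Nullary using (Dec; yes; no; contradiction)
open import Relation.Unary using (Satisfiable)
open import Algebra.Properties.CommutativeMonoid.Sum +-0-commutativeMonoid using (sum; ∑-comm)
open import Defs

open Equivalence using (to; from)

-- Binary vectors

lineSum≤n : ∀ {n} (v : Vector (Fin 2) n) → lineSum v ≤ n
lineSum≤n {zero}  v = z≤n
lineSum≤n {suc n} v = ℕₚ.+-mono-≤ (s≤s⁻¹ (toℕ<n (head v))) (lineSum≤n (tail v))

lineSum>0⇒∃1 : ∀ {n} (v : Vector (Fin 2) n) → 0 < lineSum v → ∃ λ j → v j ≡ 1F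
lineSum>0⇒∃1 {suc n} v 0<Σ with v zero in eq
... | 1F = zero , eq
... | 0F = let j , vj≡1 = lineSum>0⇒∃1 (tail v) 0<Σ in suc j , vj≡1

lineSum-mono : ∀ {n} (u v : Vector (Fin 2) n) →
               (∀ j → u j ≡ 1F → v j ≡ 1F) → lineSum u ≤ lineSum v
lineSum-mono {zero}  u v u⊆v = z≤n
lineSum-mono {suc n} u v u⊆v with u zero in eqᵤ | v zero in eqᵥ
... | 0F | x  = ℕₚ.m≤n⇒m≤o+n (toℕ x) (lineSum-mono (tail u) (tail v) (u⊆v ∘ suc))
... | 1F | 1F = s≤s (lineSum-mono (tail u) (tail v) (u⊆v ∘ suc))
... | 1F | 0F = contradiction (trans (sym eqᵥ) (u⊆v zero eqᵤ)) λ ()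

-- Where `u` is zero and `v` is one, the tail of `v` would have fewer ones than the tail of `u`,
-- against monotonicity. Equal column sums enter `starts-at-multiple` through this lemma.
⊆∧lineSum≡⇒⊇ : ∀ {n} (u v : Vector (Fin 2) n) → (∀ j → u j ≡ 1F → v j ≡ 1F) →
               lineSum u ≡ lineSum v → ∀ j → v j ≡ 1F → u j ≡ 1F
⊆∧lineSum≡⇒⊇ {suc n} u v u⊆v Σ≡ j vj≡1 with u zero in eqᵤ | v zero in eqᵥ
... | 1F | 0F = contradiction (trans (sym eqᵥ) (u⊆v zero eqᵤ)) λ ()
... | 0F | 1F = contradiction (subst (_≤ _) Σ≡ (lineSum-mono (tail u) (tail v) (u⊆v ∘ suc))) (ℕₚ.<-irrefl refl)
⊆∧lineSum≡⇒⊇ {suc n} u v u⊆v Σ≡ zero    vj≡1 | 0F | 0F = contradiction (trans (sym eqᵥ) vj≡1) λ ()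
⊆∧lineSum≡⇒⊇ {suc n} u v u⊆v Σ≡ (suc j) vj≡1 | 0F | 0F = ⊆∧lineSum≡⇒⊇ (tail u) (tail v) (u⊆v ∘ suc) Σ≡ j vj≡1
⊆∧lineSum≡⇒⊇ {suc n} u v u⊆v Σ≡ zero    vj≡1 | 1F | 1F = eqᵤ
⊆∧lineSum≡⇒⊇ {suc n} u v u⊆v Σ≡ (suc j) vj≡1 | 1F | 1F = ⊆∧lineSum≡⇒⊇ (tail u) (tail v) (u⊆v ∘ suc) (ℕₚ.suc-injective Σ≡) j vj≡1

-- Intervals of ones

-- Half-open, and free to overrun the length `n`; the bound `c + k ≤ n` is therefore carried
-- separately wherever `k` has to be the number of ones.
IsInterval : ∀ {n} → ℕ → ℕ → Vector (Fin 2) n → Set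
IsInterval c k v = ∀ j → v j ≡ 1F ⇔ (c ≤ toℕ j × toℕ j < c + k)

interval⇒consecutive : ∀ {n c k} {v : Vector (Fin 2) n} → IsInterval c k v → Consecutive v
interval⇒consecutive I x y z x≤y y≤z vx≡1 vz≡1 =
  from (I y) ( ℕₚ.≤-trans (proj₁ (to (I x) vx≡1)) x≤y
             , ℕₚ.≤-<-trans y≤z (proj₂ (to (I z) vz≡1)))

lineSum-interval : ∀ {n} c k (v : Vector (Fin 2) n) → c + k ≤ n → IsInterval c k v → lineSum v ≡ k
lineSum-interval {zero}  zero    zero    v c+k≤n I = refl
lineSum-interval {suc n} (suc c) k       v (s≤s c+k≤n) I with v zero in eq
... | 1F = contradiction (proj₁ (to (I zero) eq)) λ ()
... | 0F = lineSum-interval c k (tail v) c+k≤n λ j → mk⇔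
  (λ vj≡1 → let c≤j , j<c+k = to (I (suc j)) vj≡1 in s≤s⁻¹ c≤j , s≤s⁻¹ j<c+k)
  (λ (c≤j , j<c+k) → from (I (suc j)) (s≤s c≤j , s≤s j<c+k))
lineSum-interval {suc n} zero    zero    v c+k≤n I with v zero in eq
... | 1F = contradiction (proj₂ (to (I zero) eq)) λ ()
... | 0F = lineSum-interval 0 0 (tail v) z≤n λ j → mk⇔
  (λ vj≡1 → contradiction (proj₂ (to (I (suc j)) vj≡1)) λ ())
  λ ()
lineSum-interval {suc n} zero    (suc k) v (s≤s k≤n) I with v zero in eq
... | 0F = contradiction (trans (sym eq) (from (I zero) (z≤n , s≤s z≤n))) λ ()
... | 1F = cong suc (lineSum-interval 0 k (tail v) k≤n λ j → mk⇔
  (λ vj≡1 → z≤n , s≤s⁻¹ (proj₂ (to (I (suc j)) vj≡1)))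
  (λ (_ , j<k) → from (I (suc j)) (z≤n , s≤s j<k)))

initial⇒interval : ∀ {n} (v : Vector (Fin 2) n) →
                   (∀ i j → toℕ i ≤ toℕ j → v j ≡ 1F → v i ≡ 1F) → IsInterval 0 (lineSum v) v
initial⇒interval {suc n} v ↓ j = mk⇔ (λ vj≡1 → z≤n , ⇒ j vj≡1) (⇐ j ∘ proj₂)
  where
  rec = initial⇒interval (tail v) (λ x y x≤y → ↓ (suc x) (suc y) (s≤s x≤y))

  ⇒ : ∀ j → v j ≡ 1F → toℕ j < lineSum v
  ⇒ j vj≡1 with v zero in eq
  ⇒ j       vj≡1 | 0F = contradiction (trans (sym eq) (↓ zero j z≤n vj≡1)) λ ()
  ⇒ zero    vj≡1 | 1F = s≤s z≤n
  ⇒ (suc j) vj≡1 | 1F = s≤s (proj₂ (to (rec j) vj≡1))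

  ⇐ : ∀ j → toℕ j < lineSum v → v j ≡ 1F
  ⇐ j j<Σ with v zero in eq
  ⇐ zero    j<Σ | 1F = eq
  ⇐ (suc j) j<Σ | 1F = from (rec j) (z≤n , s≤s⁻¹ j<Σ)
  ⇐ j       j<Σ | 0F =
    let x , vx≡1 = lineSum>0⇒∃1 (tail v) (ℕₚ.≤-<-trans z≤n j<Σ)
    in contradiction (trans (sym eq) (↓ zero (suc x) z≤n vx≡1)) λ ()

-- A leading zero shifts the interval of the tail by one. After a leading one, convexity makes the
-- ones an initial segment. A zero vector gets the empty interval at `c = n`.
consecutive⇒interval : ∀ {n} (v : Vector (Fin 2) n) → Consecutive v →
                       ∃ λ c → c + lineSum v ≤ n × IsInterval c (lineSum v) v
consecutive⇒interval {zero}  v C = 0 , z≤n , λ ()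
consecutive⇒interval {suc n} v C with v zero in eq
... | 1F = 0 , s≤s (lineSum≤n (tail v)) ,
  subst (λ x → IsInterval 0 (toℕ x + lineSum (tail v)) v) eq
    (initial⇒interval v λ i j i≤j vj≡1 → C zero i j z≤n i≤j eq vj≡1)
... | 0F = suc c , s≤s c+k≤n , λ where
    zero    → mk⇔ (λ v0≡1 → contradiction (trans (sym eq) v0≡1) λ ()) λ ()
    (suc j) → mk⇔
      (λ vj≡1 → let c≤j , j<c+k = to (I j) vj≡1 in s≤s c≤j , s≤s j<c+k)
      (λ (c≤j , j<c+k) → from (I j) (s≤s⁻¹ c≤j , s≤s⁻¹ j<c+k))
  where
  rec = consecutive⇒interval (tail v)
          (λ x y z x≤y y≤z → C (suc x) (suc y) (suc z) (s≤s x≤y) (s≤s y≤z))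
  c     = proj₁ rec
  c+k≤n = proj₁ (proj₂ rec)
  I     = proj₂ (proj₂ rec)

n/k-bounds : ∀ n k .{{_ : NonZero k}} → n / k ℕ.* k ≤ n × n < n / k ℕ.* k + k
n/k-bounds n k = m/n*n≤m n k , (begin-strict
  n                       ≡⟨ m≡m%n+[m/n]*n n k ⟩
  n % k + n / k ℕ.* k     <⟨ ℕₚ.+-monoˡ-< _ (m%n<n n k) ⟩
  k + n / k ℕ.* k         ≡⟨ ℕₚ.+-comm k _ ⟩
  n / k ℕ.* k + k         ∎)
  where open ≤-Reasoning

-- Matrices with constant line sums

sum-const : ∀ {n} (f : Vector ℕ n) x → (∀ j → f j ≡ x) → sum f ≡ n ℕ.* x
sum-const {zero}  f x f≡x = refl
sum-const {suc n} f x f≡x = cong₂ _+_ (f≡x zero) (sum-const (tail f) x (f≡x ∘ suc))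

double-counting : ∀ {m n k l} (A : Matrix01 m n) →
                  (∀ i → rowSums A i ≡ k) → (∀ j → colSums A j ≡ l) → m ℕ.* k ≡ n ℕ.* l
double-counting {m} {n} {k} {l} A rowSum colSum = begin
  m ℕ.* k           ≡⟨ sum-const (rowSums A) k rowSum ⟨
  sum (rowSums A)   ≡⟨ ∑-comm (λ i j → toℕ (A i j)) ⟩
  sum (colSums A)   ≡⟨ sum-const (colSums A) l colSum ⟩
  n ℕ.* l           ∎
  where open ≡-Reasoning

module _ {m n k l : ℕ} (0<k : 0 < k) (0<l : 0 < l) (A : Matrix01 m n)
         (s : Fin m → ℕ) (s+k≤n : ∀ i → s i + k ≤ n) (I : ∀ i → IsInterval (s i) k (A i))
         (colSum : ∀ j → colSums A j ≡ l) where

  private instance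
    k≢0 : NonZero k
    k≢0 = ℕ.>-nonZero 0<k

  -- Induction on `q`, for all rows at once: the step applies the hypothesis to every row meeting
  -- the previous multiple of `k`, not only to row `i`.
  starts-at-multiple : ∀ q (x : Fin n) i → toℕ x ≡ q ℕ.* k → A i x ≡ 1F → s i ≡ q ℕ.* k
  starts-at-multiple zero    x i x≡0 Aix≡1 =
    ℕₚ.n≤0⇒n≡0 (subst (s i ≤_) x≡0 (proj₁ (to (I i x) Aix≡1)))
  starts-at-multiple (suc q) x i x≡d Aix≡1 = ℕₚ.≤-antisym si≤d (ℕₚ.≮⇒≥ si≮d)
    where
    c = q ℕ.* k
    d = k + c

    si≤d : s i ≤ d
    si≤d = subst (s i ≤_) x≡d (proj₁ (to (I i x) Aix≡1))

    d<n : d < n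
    d<n = subst (_< n) x≡d (toℕ<n x)

    c<d : c < d
    c<d = ℕₚ.m<n+m c 0<k

    1+[d-1]≡d : suc (pred d) ≡ d
    1+[d-1]≡d = ℕₚ.suc-pred d {{ℕ.>-nonZero (ℕₚ.≤-<-trans z≤n c<d)}}

    d-1<d : pred d < d
    d-1<d = ℕₚ.≤-reflexive 1+[d-1]≡d

    <d⇒≤d-1 : ∀ {a} → a < d → a ≤ pred d
    <d⇒≤d-1 {a} a<d = s≤s⁻¹ (subst (a <_) (sym 1+[d-1]≡d) a<d)

    -- The first and last columns of the block of width `k` just before column `x`; they coincide
    -- when `k` is 1.
    y z : Fin n
    y = fromℕ< (ℕₚ.<-trans c<d d<n)
    z = fromℕ< (ℕₚ.<-trans d-1<d d<n)

    y≡c : toℕ y ≡ c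
    y≡c = toℕ-fromℕ< _

    z≡d-1 : toℕ z ≡ pred d
    z≡d-1 = toℕ-fromℕ< _

    -- By induction such a row starts exactly at `c`, so its `k` ones run up to `pred d`.
    y⊆z : ∀ i′ → A i′ y ≡ 1F → A i′ z ≡ 1F
    y⊆z i′ Ai′y≡1 = from (I i′ z)
      ( subst (s i′ ≤_) (sym z≡d-1) (subst (_≤ pred d) (sym si′≡c) (<d⇒≤d-1 c<d))
      , (begin-strict
          toℕ z      ≡⟨ z≡d-1 ⟩
          pred d     <⟨ d-1<d ⟩
          k + c      ≡⟨ ℕₚ.+-comm k c ⟩
          c + k      ≡⟨ cong (_+ k) si′≡c ⟨
          s i′ + k   ∎))
      where
      open ≤-Reasoning
      si′≡c = starts-at-multiple q y i′ y≡c Ai′y≡1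

    -- A row starting before `d` and reaching `x` passes through `z`, hence through `y` by equality
    -- of the two columns. It then starts at `c` and ends before `d`, so it misses `x`.
    si≮d : s i ℕ.≮ d
    si≮d si<d = ℕₚ.<-irrefl refl (begin-strict
      d         <⟨ d<si+k ⟩
      s i + k   ≡⟨ cong (_+ k) (starts-at-multiple q y i y≡c Aiy≡1) ⟩
      c + k     ≡⟨ ℕₚ.+-comm c k ⟩
      d         ∎)
      where
      open ≤-Reasoning
      d<si+k : d < s i + k
      d<si+k = subst (_< s i + k) x≡d (proj₂ (to (I i x) Aix≡1))

      Aiz≡1 : A i z ≡ 1F
      Aiz≡1 = from (I i z)
        ( subst (s i ≤_) (sym z≡d-1) (<d⇒≤d-1 si<d)
        , subst (_< s i + k) (sym z≡d-1) (ℕₚ.<-trans d-1<d d<si+k))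

      Aiy≡1 : A i y ≡ 1F
      Aiy≡1 = ⊆∧lineSum≡⇒⊇ (transpose A y) (transpose A z) y⊆z
                (trans (colSum y) (sym (colSum z))) i Aiz≡1

  -- If a remainder were left, column `n / k * k` would exist and, as `l` is positive, meet some
  -- row. That row starts there and needs `k` columns, but fewer than `k` remain.
  n≡[n/k]*k : n ≡ n / k ℕ.* k
  n≡[n/k]*k with n / k ℕ.* k ℕ.<? n
  ... | no  ≮n = ℕₚ.≤-antisym (ℕₚ.≮⇒≥ ≮n) (m/n*n≤m n k)
  ... | yes <n = contradiction n<[n/k]*k+k (ℕₚ.≤⇒≯ [n/k]*k+k≤n)
    where
    open ≤-Reasoning
    x    = fromℕ< <n
    i,Ai = lineSum>0⇒∃1 (transpose A x) (subst (0 <_) (sym (colSum x)) 0<l)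
    i    = proj₁ i,Ai

    [n/k]*k+k≤n : n / k ℕ.* k + k ≤ n
    [n/k]*k+k≤n = subst (λ a → a + k ≤ n)
      (starts-at-multiple (n / k) x i (toℕ-fromℕ< <n) (proj₂ i,Ai)) (s+k≤n i)

    n<[n/k]*k+k : n < n / k ℕ.* k + k
    n<[n/k]*k+k = proj₂ (n/k-bounds n k)

convex-class⇒dims : ∀ {m n k l} → 0 < k → 0 < l →
                    Satisfiable (𝒞 m n (replicate m k) (replicate n l)) →
                    ∃ λ p → m ≡ p ℕ.* l × n ≡ p ℕ.* k
convex-class⇒dims {m} {n} {k} {l} 0<k 0<l (A , A∈𝒞) = p , m≡p*l , n≡p*k
  where
  open IsInClass A∈𝒞
  instance
    k≢0 : NonZero k
    k≢0 = ℕ.>-nonZero 0<k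

  interval : ∀ i → ∃ λ c → c + k ≤ n × IsInterval c k (A i)
  interval i = subst (λ a → ∃ λ c → c + a ≤ n × IsInterval c a (A i)) (rowSums≗R i)
    (consecutive⇒interval (A i) (Convex.rows convex i))

  p = n / k

  n≡p*k : n ≡ p ℕ.* k
  n≡p*k = n≡[n/k]*k 0<k 0<l A (proj₁ ∘ interval) (proj₁ ∘ proj₂ ∘ interval)
            (λ i → proj₂ (proj₂ (interval i))) colSums≗S

  m≡p*l : m ≡ p ℕ.* l
  -- Both sides times `k` count the ones of `A`; `k` is positive and cancels.
  m≡p*l = ℕₚ.*-cancelʳ-≡ m (p ℕ.* l) k (begin
    m ℕ.* k           ≡⟨ double-counting A rowSums≗R colSums≗S ⟩
    n ℕ.* l           ≡⟨ cong (ℕ._* l) n≡p*k ⟩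
    p ℕ.* k ℕ.* l     ≡⟨ ℕₚ.*-assoc p k l ⟩
    p ℕ.* (k ℕ.* l)   ≡⟨ cong (p ℕ.*_) (ℕₚ.*-comm k l) ⟩
    p ℕ.* (l ℕ.* k)   ≡⟨ ℕₚ.*-assoc p l k ⟨
    p ℕ.* l ℕ.* k     ∎)
    where open ≡-Reasoning

-- Block diagonal matrices

indicator : ∀ {P : Set} → Dec P → Fin 2
indicator (yes _) = 1F
indicator (no  _) = 0F

indicator≡1⇔ : ∀ {P : Set} (P? : Dec P) → indicator P? ≡ 1F ⇔ P
indicator≡1⇔ (yes p) = mk⇔ (λ _ → p) (λ _ → refl)
indicator≡1⇔ (no ¬p) = mk⇔ (λ ()) (λ p → contradiction p ¬p)

-- Division by `k` is constant exactly on the blocks from `q * k` to `q * k + k - 1`. Stated for a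
-- vector `v`, it serves rows and, with `l` for `k`, columns of the block matrix.
quotient-interval : ∀ {p k} .{{_ : NonZero k}} {q} {v : Vector (Fin 2) (p ℕ.* k)} → q < p →
                    (∀ j → v j ≡ 1F ⇔ toℕ j / k ≡ q) →
                    q ℕ.* k + k ≤ p ℕ.* k × IsInterval (q ℕ.* k) k v
quotient-interval {p} {k} {q} {v} q<p v⇔ =
    subst (_≤ p ℕ.* k) (ℕₚ.+-comm k (q ℕ.* k)) (ℕₚ.*-monoˡ-≤ k q<p)
  , λ j → mk⇔
      (λ vj≡1 → subst (λ a → a ℕ.* k ≤ toℕ j × toℕ j < a ℕ.* k + k) (to (v⇔ j) vj≡1) (n/k-bounds (toℕ j) k))
      (λ (qk≤j , j<qk+k) → from (v⇔ j) (ℕₚ.≤-antisym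
        (s≤s⁻¹ (m<n*o⇒m/o<n (subst (toℕ j <_) (ℕₚ.+-comm (q ℕ.* k) k) j<qk+k)))
        (subst (_≤ toℕ j / k) (m*n/n≡m q k) (/-monoˡ-≤ k qk≤j))))

-- The quotients are block numbers: rows are grouped by `l` and columns by `k`, and an entry is one
-- when the two numbers agree.
blockDiagonal : ∀ p k l .{{_ : NonZero k}} .{{_ : NonZero l}} → Matrix01 (p ℕ.* l) (p ℕ.* k)
blockDiagonal p k l i j = indicator (toℕ i / l ℕ.≟ toℕ j / k)

blockDiagonal∈𝒞 : ∀ p k l .{{_ : NonZero k}} .{{_ : NonZero l}} →
                  𝒞 (p ℕ.* l) (p ℕ.* k) (replicate _ k) (replicate _ l) (blockDiagonal p k l)
blockDiagonal∈𝒞 p k l = record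
  { rowSums≗R = λ i → lineSum-interval _ k _ (proj₁ (row i)) (proj₂ (row i))
  ; colSums≗S = λ j → lineSum-interval _ l _ (proj₁ (col j)) (proj₂ (col j))
  ; convex    = record
    { rows = λ i → interval⇒consecutive (proj₂ (row i))
    ; cols = λ j → interval⇒consecutive (proj₂ (col j))
    }
  }
  where
  A = blockDiagonal p k l

  row : ∀ i → toℕ i / l ℕ.* k + k ≤ p ℕ.* k × IsInterval (toℕ i / l ℕ.* k) k (A i)
  row i = quotient-interval {p} (m<n*o⇒m/o<n (toℕ<n i)) λ j →
    let e = indicator≡1⇔ (toℕ i / l ℕ.≟ toℕ j / k) in mk⇔ (sym ∘ to e) (from e ∘ sym)

  col : ∀ j → toℕ j / k ℕ.* l + l ≤ p ℕ.* l × IsInterval (toℕ j / k ℕ.* l) l (transpose A j)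
  col j = quotient-interval {p} (m<n*o⇒m/o<n (toℕ<n j)) λ i →
    indicator≡1⇔ (toℕ i / l ℕ.≟ toℕ j / k)

mainTheorem6 : ∀ (m n k l : ℕ) → 0 < k → 0 < l → k ≤ m → l ≤ n →
    Satisfiable (𝒞 m n (replicate m k) (replicate n l)) ⇔ (∃ λ (p : ℤ) → + m ≡ p * + l × + n ≡ p * + k)
mainTheorem6 m n k l 0<k 0<l _ _ = mk⇔ ⇒ ⇐
  where
  instance
    k≢0 : NonZero k
    k≢0 = ℕ.>-nonZero 0<k

    l≢0 : NonZero l
    l≢0 = ℕ.>-nonZero 0<l

  ⇒ : Satisfiable (𝒞 m n (replicate m k) (replicate n l)) → ∃ λ (p : ℤ) → + m ≡ p * + l × + n ≡ p * + k
  ⇒ sat with p , m≡p*l , n≡p*k ← convex-class⇒dims 0<k 0<l sat =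
    + p , trans (cong +_ m≡p*l) (pos-* p l) , trans (cong +_ n≡p*k) (pos-* p k)

  ⇐ : (∃ λ (p : ℤ) → + m ≡ p * + l × + n ≡ p * + k) → Satisfiable (𝒞 m n (replicate m k) (replicate n l))
  -- Absolute values turn both integer equations into equations of naturals, so the sign of `p`
  -- needs no case split and `∣ p ∣` counts the blocks.
  ⇐ (p , m≡p*l , n≡p*k)
    with refl ← trans (cong ∣_∣ m≡p*l) (abs-* p (+ l))
       | refl ← trans (cong ∣_∣ n≡p*k) (abs-* p (+ k))
    = blockDiagonal (∣ p ∣) k l , blockDiagonal∈𝒞 (∣ p ∣) k l
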